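{- Let $S$ be a commutative semiring. For each WAFA $\mathcal A$ over $S$ and an alphabet $\Sigma$ there exists an equivalent WAFA $\mathcal A'$ over $S$ and $\Sigma$ that is equalized and nice. The construction of $\mathcal A'$ is effective.
   Context: An alphabet is a finite non-empty set; $\Sigma^*$ is the set of finite words over $\Sigma$, $\varepsilon$ the empty word. A semiring $(S,+,\cdot,0,1)$ has $(S,+,0)$ a commutative monoid, $(S,\cdot,1)$ a monoid, $0$ absorbing, and both distributive laws; it is commutative if $\cdot$ is commutative. For $Q=\{q_1,\dots,q_n\}$, $S[Q]$ is the semiring of polynomials with coefficients in $S$ in commuting indeterminates $q_1,\dots,q_n$; $p\langle s_1,\dots,s_n\rangle$ denotes simultaneous substitution. A monomial is $s\cdot q_1^{k_1}\cdots q_n^{k_n}$ with coefficient $s\in S$ and $k_i\in\mathbb N$; its degree is $\sum_i k_i$; it is proper if its degree is non-zero. The zero polynomial is the empty sum of monomials. A weighted alternating finite automaton (WAFA) over $S$ and $\Sigma$ is $\mathcal A=(Q,\Sigma,\delta,P_0,\tau)$ with $Q=\{q_1,\dots,q_n\}$ a finite set of states, $\delta:Q\times\Sigma\to S[Q]$, $P_0\in S[Q]$, $\tau:Q\to S$. State behavior: $[\mathcal A]_q(\varepsilon)=\tau(q)$, $[\mathcal A]_q(av)=\delta(q,a)\langle[\mathcal A]_{q_1}(v),\dots,[\mathcal A]_{q_n}(v)\rangle$ for $a\in\Sigma$. Behavior: $[\![\mathcal A]\!](w)=P_0\langle[\mathcal A]_{q_1}(w),\dots,[\mathcal A]_{q_n}(w)\rangle$.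 Two WAFA are equivalent if they have the same behavior. A WAFA is nice if: (i) $\delta(q,a)$ is a finite sum of pairwise distinct monomials of the form $s\cdot q_1^{k_1}\cdots q_n^{k_n}$ for all $q\in Q$, $a\in\Sigma$; (ii) all monomials in $P_0$ and $\delta$ are proper; (iii) $P_0=q_1$. A WAFA is equalized if all monomials occurring in $\delta$ (i.e. in any $\delta(q,a)$) have the same degree. -}

module Defs where

open import Algebra.Bundles using (CommutativeSemiring)
import Algebra.Definitions.RawSemiring as RawSemiringDefinitions
open import Data.Bool.Base using (if_then_else_)
open import Data.Fin.Base using (Fin; toℕ)
import Data.Fin.Properties as Fin
open import Data.List.Base using (List; []; _∷_; [_]; map)
open import Data.List.Membership.Propositional using (_∈_)
open import Data.List.Relation.Unary.Unique.Propositional using (Unique)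
open import Data.Nat.Base using (ℕ; suc)
import Data.Nat.Properties as ℕ
open import Data.Product.Base using (∃; _×_)
open import Data.Vec.Base using (Vec; lookup; sum; tabulate)
open import Data.Vec.Properties using (≡-dec)
open import Function.Bundles using (_↔_)
open import Level using (Level; _⊔_) renaming (suc to lsuc)
open import Relation.Binary.PropositionalEquality.Core using (_≡_; _≢_)
open import Relation.Nullary.Decidable.Core using (does)

record Alphabet (a : Level) : Set (lsuc a) where
  field
    Letter      : Set a
    size-1      : ℕ
    enumeration : Letter ↔ Fin (suc size-1)

open Alphabet public

module _ {c ℓ : Level} (S : CommutativeSemiring c ℓ) where

  open CommutativeSemiring S using (Carrier)

  -- s · q₁^k₁ ⋯ qₙ^kₙ, with the exponents listed as k₁ ∷ … ∷ kₙ ∷ [].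
  record Monomial (n : ℕ) : Set c where
    constructor _·q^_
    field
      coefficient : Carrier
      exponents   : Vec ℕ n

  -- Elements of S[q₁,…,qₙ], presented as finite sums of monomials.  A
  -- presentation may repeat an exponent vector or list a zero coefficient;
  -- equality in S[q₁,…,qₙ] is _≈ₚ_ below.
  Polynomial : ℕ → Set c
  Polynomial n = List (Monomial n)

open Monomial public

module _ {c ℓ : Level} {S : CommutativeSemiring c ℓ} where

  open CommutativeSemiring S using (Carrier; _≈_; _+_; _*_; 0#; 1#; rawSemiring)
  open RawSemiringDefinitions rawSemiring using (_^_; product)

  degree : ∀ {n} → Monomial S n → ℕ
  degree m = sum (exponents m)

  Proper : ∀ {n} → Monomial S n → Set
  Proper m = degree m ≢ 0

  coefficientOf : ∀ {n} → Vec ℕ n → Polynomial S n → Carrier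
  coefficientOf k []      = 0#
  coefficientOf k (m ∷ p) =
    if does (≡-dec ℕ._≟_ (exponents m) k)
    then coefficient m + coefficientOf k p
    else coefficientOf k p

  infix 4 _≈ₚ_
  _≈ₚ_ : ∀ {n} → Polynomial S n → Polynomial S n → Set ℓ
  p ≈ₚ p′ = ∀ k → coefficientOf k p ≈ coefficientOf k p′

  indeterminate : ∀ {n} → Fin n → Polynomial S n
  indeterminate i =
    [ 1# ·q^ tabulate (λ j → if does (i Fin.≟ j) then 1 else 0) ]

  substMonomial : ∀ {n} → Monomial S n → (Fin n → Carrier) → Carrier
  substMonomial m s = coefficient m * product (λ i → s i ^ lookup (exponents m) i)

  infix 9 _⟨_⟩
  _⟨_⟩ : ∀ {n} → Polynomial S n → (Fin n → Carrier) → Carrier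
  []      ⟨ s ⟩ = 0#
  (m ∷ p) ⟨ s ⟩ = substMonomial m s + p ⟨ s ⟩

-- The state qᵢ₊₁ is the element of Fin ∣Q∣ with toℕ equal to i.
record WAFA {c ℓ a : Level} (S : CommutativeSemiring c ℓ) (A : Alphabet a)
            : Set (c ⊔ a) where
  field
    ∣Q∣ : ℕ
    δ   : Fin ∣Q∣ → Letter A → Polynomial S ∣Q∣
    P₀  : Polynomial S ∣Q∣
    τ   : Fin ∣Q∣ → CommutativeSemiring.Carrier S

module _ {c ℓ a : Level} {S : CommutativeSemiring c ℓ} {A : Alphabet a} where

  open CommutativeSemiring S using (Carrier; _≈_)
  open WAFA

  stateBehavior : (𝒜 : WAFA S A) → List (Letter A) → Fin (∣Q∣ 𝒜) → Carrier
  stateBehavior 𝒜 []      q = τ 𝒜 q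
  stateBehavior 𝒜 (x ∷ v) q = δ 𝒜 q x ⟨ stateBehavior 𝒜 v ⟩

  behavior : WAFA S A → List (Letter A) → Carrier
  behavior 𝒜 w = P₀ 𝒜 ⟨ stateBehavior 𝒜 w ⟩

  Equivalent : WAFA S A → WAFA S A → Set (a ⊔ ℓ)
  Equivalent 𝒜 ℬ = ∀ w → behavior 𝒜 w ≈ behavior ℬ w

  -- Conditions on monomials range over all listed monomials, not only those
  -- with coefficient ≉ 0#, since ≈ 0# need not be decidable.  Monomials count
  -- as distinct when their exponent vectors differ, so under distinct-monomials
  -- every exponent vector with a nonzero coefficient is listed exactly once.
  record Nice (𝒜 : WAFA S A) : Set (c ⊔ ℓ ⊔ a) where
    field
      distinct-monomials : ∀ q x → Unique (map exponents (δ 𝒜 q x))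
      δ-proper           : ∀ q x {m} → m ∈ δ 𝒜 q x → Proper m
      P₀-proper          : ∀ {m} → m ∈ P₀ 𝒜 → Proper m
      P₀-is-q₁           : ∃ λ (q₁ : Fin (∣Q∣ 𝒜)) →
                             toℕ q₁ ≡ 0 × P₀ 𝒜 ≈ₚ indeterminate q₁

  Equalized : WAFA S A → Set (c ⊔ a)
  Equalized 𝒜 = ∀ q x q′ x′ {m m′} →
    m ∈ δ 𝒜 q x → m′ ∈ δ 𝒜 q′ x′ → degree m ≡ degree m′

{-# OPTIONS --safe #-}

-- Two states are added to the n states of 𝒜.  The state q₁ takes at a word the
-- value of P₀; its transitions are the polynomials obtained by substituting
-- the δ(q, a) into P₀.  The state e has constant value 1, so multiplying a
-- monomial by a power of e does not change its value; this raises all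
-- monomials to a common positive degree.  Finally, monomials with equal
-- exponents are merged.
module Submission where

open import Defs
open import Algebra.Bundles using (CommutativeSemiring)
open import Data.Product.Base using (_×_; ∃-syntax)
open import Level using (Level)

import Algebra.Properties.CommutativeMonoid.Sum as CommutativeMonoidSum
import Algebra.Properties.CommutativeSemigroup as CommutativeSemigroupProperties
import Algebra.Properties.CommutativeSemiring.Exp as Exp
open import Data.Fin.Base using (Fin; zero; suc)
open import Data.List.Base
  using (List; []; _∷_; [_]; _++_; map; foldr; concat; cartesianProductWith; allFin)
open import Data.List.Extrema.Nat using (max; xs≤max)
open import Data.List.Membership.Propositional using (_∈_)
open import Data.List.Membership.Propositional.Properties
  using (∈-allFin; ∈-cartesianProductWith⁺; ∈-concat⁺′; ∈-map⁺)
open import Data.List.Relation.Unary.All using (All; []; _∷_)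
import Data.List.Relation.Unary.All as All
import Data.List.Relation.Unary.All.Properties as All
open import Data.List.Relation.Unary.AllPairs using ([]; _∷_)
open import Data.List.Relation.Unary.Any using (here)
open import Data.List.Relation.Unary.Unique.Propositional using (Unique)
open import Data.Nat.Base using (ℕ; suc; _∸_; _≤_)
import Data.Nat.Base as ℕ
import Data.Nat.Properties as ℕ
open import Data.Product.Base using (_,_)
open import Data.Vec.Base using (Vec; _∷_; lookup; replicate; sum; tabulate; zipWith)
open import Data.Vec.Properties
  using (≡-dec; lookup-replicate; lookup-zipWith; lookup∘tabulate)
import Data.Vec.Functional as Vector
open import Function.Base using (_∘_)
open import Function.Bundles using (Inverse)
import Relation.Binary.PropositionalEquality.Core as ≡
open ≡ using (_≡_; _≢_; subst)
import Relation.Binary.Reasoning.Setoid as SetoidReasoning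
open import Relation.Nullary.Decidable.Core using (yes; no)

module PolynomialArithmetic {c ℓ : Level} (S : CommutativeSemiring c ℓ) where

  open CommutativeSemiring S hiding (zero)
  open Exp S using (_^_; ^-homo-*; ^-congˡ; ^-congʳ)
  open CommutativeMonoidSum *-commutativeMonoid
    using ()
    renaming (sum to ∏; sum-cong-≋ to ∏-cong; ∑-distrib-+ to ∏-distrib-*;
              sum-replicate-zero to ∏-replicate-1#)
  open CommutativeSemigroupProperties *-commutativeSemigroup using (interchange)
  open CommutativeSemigroupProperties +-commutativeSemigroup
    using ()
    renaming (x∙yz≈y∙xz to x+[y+z]≈y+[x+z])
  open SetoidReasoning setoid

  private
    variable
      n n′ : ℕ

  -- Evaluation of monomials and polynomials.

  infixr 8 _^ᵛ_
  _^ᵛ_ : (Fin n → Carrier) → Vec ℕ n → Carrier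
  s ^ᵛ k = ∏ (λ i → s i ^ lookup k i)

  ^ᵛ-zero : ∀ (s : Fin n → Carrier) k → (∀ i → lookup k i ≡ 0) → s ^ᵛ k ≈ 1#
  ^ᵛ-zero {n} s k k≡0 =
    trans (∏-cong (λ i → ^-congʳ (s i) (k≡0 i))) (∏-replicate-1# n)

  ^ᵛ-homo-* : ∀ (s : Fin n → Carrier) k k′ →
              s ^ᵛ zipWith ℕ._+_ k k′ ≈ s ^ᵛ k * s ^ᵛ k′
  ^ᵛ-homo-* s k k′ = trans
    (∏-cong λ i → trans (^-congʳ (s i) (lookup-zipWith ℕ._+_ i k k′))
                        (^-homo-* (s i) (lookup k i) (lookup k′ i)))
    (∏-distrib-* (λ i → s i ^ lookup k i) (λ i → s i ^ lookup k′ i))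

  1#^n≈1# : ∀ n → 1# ^ n ≈ 1#
  1#^n≈1# ℕ.zero  = refl
  1#^n≈1# (suc n) = trans (*-identityˡ _) (1#^n≈1# n)

  ⟨⟩-cong : ∀ (p : Polynomial S n) {s t} → (∀ i → s i ≈ t i) →
            p ⟨ s ⟩ ≈ p ⟨ t ⟩
  ⟨⟩-cong []      s≈t = refl
  ⟨⟩-cong (m ∷ p) s≈t = +-cong
    (*-congˡ (∏-cong λ i → ^-congˡ (lookup (exponents m) i) (s≈t i)))
    (⟨⟩-cong p s≈t)

  ++-⟨⟩ : ∀ (p q : Polynomial S n) s → (p ++ q) ⟨ s ⟩ ≈ p ⟨ s ⟩ + q ⟨ s ⟩
  ++-⟨⟩ []      q s = sym (+-identityˡ _)
  ++-⟨⟩ (m ∷ p) q s = trans (+-congˡ (++-⟨⟩ p q s)) (sym (+-assoc _ _ _))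

  -- Covers two uses: multiplication by a fixed monomial, with `x` its value and `t` equal to `s`,
  -- and padding, with `x` equal to `1#` and a change in the number of indeterminates.
  map-⟨⟩ : ∀ (f : Monomial S n → Monomial S n′) x s t →
           (∀ m → substMonomial (f m) s ≈ x * substMonomial m t) →
           ∀ p → map f p ⟨ s ⟩ ≈ x * p ⟨ t ⟩
  map-⟨⟩ f x s t f≈ []      = sym (zeroʳ x)
  map-⟨⟩ f x s t f≈ (m ∷ p) =
    trans (+-cong (f≈ m) (map-⟨⟩ f x s t f≈ p)) (sym (distribˡ x _ _))

  -- Products, powers and composition of polynomials.

  constant : Carrier → Polynomial S n
  constant x = [ x ·q^ replicate _ 0 ]

  constant-⟨⟩ : ∀ x (s : Fin n → Carrier) → constant x ⟨ s ⟩ ≈ x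
  constant-⟨⟩ {n} x s = begin
    x * s ^ᵛ 0s + 0#  ≈⟨ +-identityʳ _ ⟩
    x * s ^ᵛ 0s       ≈⟨ *-congˡ (^ᵛ-zero s 0s (λ i → lookup-replicate i 0)) ⟩
    x * 1#            ≈⟨ *-identityʳ x ⟩
    x                 ∎
    where
    0s = replicate n 0

  infixl 7 _*ₘ_ _*ₚ_
  _*ₘ_ : Monomial S n → Monomial S n → Monomial S n
  (x ·q^ k) *ₘ (y ·q^ l) = (x * y) ·q^ zipWith ℕ._+_ k l

  *ₘ-subst : ∀ (m m′ : Monomial S n) s →
             substMonomial (m *ₘ m′) s ≈ substMonomial m s * substMonomial m′ s
  *ₘ-subst (x ·q^ k) (y ·q^ l) s =
    trans (*-congˡ (^ᵛ-homo-* s k l)) (interchange x y _ _)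

  -- Like terms are left uncollected here; `merge` collects them once, at the end of the
  -- construction.
  _*ₚ_ : Polynomial S n → Polynomial S n → Polynomial S n
  _*ₚ_ = cartesianProductWith _*ₘ_

  *ₚ-⟨⟩ : ∀ (p q : Polynomial S n) s → (p *ₚ q) ⟨ s ⟩ ≈ p ⟨ s ⟩ * q ⟨ s ⟩
  *ₚ-⟨⟩ []      q s = sym (zeroˡ _)
  *ₚ-⟨⟩ (m ∷ p) q s = begin
    (map (m *ₘ_) q ++ p *ₚ q) ⟨ s ⟩
      ≈⟨ ++-⟨⟩ (map (m *ₘ_) q) (p *ₚ q) s ⟩
    map (m *ₘ_) q ⟨ s ⟩ + (p *ₚ q) ⟨ s ⟩
      ≈⟨ +-cong (map-⟨⟩ (m *ₘ_) (substMonomial m s) s s (λ m′ → *ₘ-subst m m′ s) q)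
                (*ₚ-⟨⟩ p q s) ⟩
    substMonomial m s * q ⟨ s ⟩ + p ⟨ s ⟩ * q ⟨ s ⟩
      ≈⟨ distribʳ _ _ _ ⟨
    (m ∷ p) ⟨ s ⟩ * q ⟨ s ⟩  ∎

  infixr 8 _^ₚ_
  _^ₚ_ : Polynomial S n → ℕ → Polynomial S n
  p ^ₚ ℕ.zero = constant 1#
  p ^ₚ suc k  = p *ₚ p ^ₚ k

  ^ₚ-⟨⟩ : ∀ (p : Polynomial S n) k s → (p ^ₚ k) ⟨ s ⟩ ≈ p ⟨ s ⟩ ^ k
  ^ₚ-⟨⟩ p ℕ.zero  s = constant-⟨⟩ 1# s
  ^ₚ-⟨⟩ p (suc k) s = trans (*ₚ-⟨⟩ p (p ^ₚ k) s) (*-congˡ (^ₚ-⟨⟩ p k s))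

  ∏ₚ : (Fin n′ → Polynomial S n) → Polynomial S n
  ∏ₚ = Vector.foldr _*ₚ_ (constant 1#)

  ∏ₚ-⟨⟩ : ∀ (p : Fin n′ → Polynomial S n) s → ∏ₚ p ⟨ s ⟩ ≈ ∏ (λ i → p i ⟨ s ⟩)
  ∏ₚ-⟨⟩ {ℕ.zero} p s = constant-⟨⟩ 1# s
  ∏ₚ-⟨⟩ {suc n′} p s =
    trans (*ₚ-⟨⟩ (p zero) (∏ₚ (p ∘ suc)) s) (*-congˡ (∏ₚ-⟨⟩ (p ∘ suc) s))

  infix 9 _⟪_⟫
  _⟪_⟫ : Polynomial S n → (Fin n → Polynomial S n′) → Polynomial S n′
  []             ⟪ r ⟫ = []
  ((x ·q^ k) ∷ p) ⟪ r ⟫ =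
    constant x *ₚ ∏ₚ (λ i → r i ^ₚ lookup k i) ++ p ⟪ r ⟫

  ⟪⟫-⟨⟩ : ∀ (p : Polynomial S n) (r : Fin n → Polynomial S n′) s →
          (p ⟪ r ⟫) ⟨ s ⟩ ≈ p ⟨ (λ i → r i ⟨ s ⟩) ⟩
  ⟪⟫-⟨⟩ []              r s = refl
  ⟪⟫-⟨⟩ ((x ·q^ k) ∷ p) r s = trans
    (++-⟨⟩ (constant x *ₚ rᵏ) (p ⟪ r ⟫) s)
    (+-cong
      (begin
        (constant x *ₚ rᵏ) ⟨ s ⟩       ≈⟨ *ₚ-⟨⟩ (constant x) rᵏ s ⟩
        constant x ⟨ s ⟩ * rᵏ ⟨ s ⟩    ≈⟨ *-cong (constant-⟨⟩ x s) (∏ₚ-⟨⟩ (λ i → r i ^ₚ lookup k i) s) ⟩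
        x * ∏ (λ i → (r i ^ₚ lookup k i) ⟨ s ⟩)
          ≈⟨ *-congˡ (∏-cong λ i → ^ₚ-⟨⟩ (r i) (lookup k i) s) ⟩
        x * (λ i → r i ⟨ s ⟩) ^ᵛ k     ∎)
      (⟪⟫-⟨⟩ p r s))
    where
    rᵏ = ∏ₚ (λ i → r i ^ₚ lookup k i)

  indeterminate-zero-⟨⟩ : ∀ (s : Fin (suc n) → Carrier) →
                          indeterminate {S = S} zero ⟨ s ⟩ ≈ s zero
  indeterminate-zero-⟨⟩ s = begin
    -- The test `zero ≟ j` computes on constructors, so the exponent vector reduces to 1 followed by
    -- `0s`.
    1# * (s zero * 1# * s′ ^ᵛ 0s) + 0#  ≈⟨ +-identityʳ _ ⟩
    1# * (s zero * 1# * s′ ^ᵛ 0s)       ≈⟨ *-identityˡ _ ⟩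
    s zero * 1# * s′ ^ᵛ 0s
      ≈⟨ *-cong (*-identityʳ _) (^ᵛ-zero s′ 0s (lookup∘tabulate (λ _ → 0))) ⟩
    s zero * 1#                         ≈⟨ *-identityʳ _ ⟩
    s zero                              ∎
    where
    s′ = s ∘ suc
    0s = tabulate (λ _ → 0)

  -- Merging monomials with equal exponents.

  addMonomial : Monomial S n → Polynomial S n → Polynomial S n
  addMonomial m []       = [ m ]
  addMonomial m (m′ ∷ p) with ≡-dec ℕ._≟_ (exponents m) (exponents m′)
  -- Only the coefficient changes, so the list of exponents stays definitionally the same. A
  -- coefficient that sums to zero remains listed.
  ... | yes _ = ((coefficient m + coefficient m′) ·q^ exponents m′) ∷ p
  ... | no  _ = m′ ∷ addMonomial m p

  merge : Polynomial S n → Polynomial S n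
  merge = foldr addMonomial []

  addMonomial-⟨⟩ : ∀ (m : Monomial S n) p s →
                   addMonomial m p ⟨ s ⟩ ≈ (m ∷ p) ⟨ s ⟩
  addMonomial-⟨⟩ m []       s = refl
  addMonomial-⟨⟩ m (m′ ∷ p) s with ≡-dec ℕ._≟_ (exponents m) (exponents m′)
  ... | yes ≡.refl = trans (+-congʳ (distribʳ _ _ _)) (+-assoc _ _ _)
  ... | no  _      = trans (+-congˡ (addMonomial-⟨⟩ m p s)) (x+[y+z]≈y+[x+z] _ _ _)

  merge-⟨⟩ : ∀ (p : Polynomial S n) s → merge p ⟨ s ⟩ ≈ p ⟨ s ⟩
  merge-⟨⟩ []      s = refl
  merge-⟨⟩ (m ∷ p) s =
    trans (addMonomial-⟨⟩ m (merge p) s) (+-congˡ (merge-⟨⟩ p s))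

  module _ {P : Vec ℕ n → Set} where

    -- Merging alters coefficients but creates no new exponent vector, so predicates on exponents
    -- survive. Instances are being different from a given vector and having a given sum.
    addMonomial-All : ∀ {m p} → P (exponents m) → All (P ∘ exponents) p →
                      All (P ∘ exponents) (addMonomial m p)
    addMonomial-All                 Pm []         = Pm ∷ []
    addMonomial-All {m} {p = m′ ∷ _} Pm (Pm′ ∷ Pp)
      with ≡-dec ℕ._≟_ (exponents m) (exponents m′)
    ... | yes _ = Pm′ ∷ Pp
    ... | no  _ = Pm′ ∷ addMonomial-All Pm Pp

    merge-All : ∀ {p} → All (P ∘ exponents) p → All (P ∘ exponents) (merge p)
    merge-All []        = []
    merge-All (Pm ∷ Pp) = addMonomial-All Pm (merge-All Pp)

  addMonomial-unique : ∀ (m : Monomial S n) p → Unique (map exponents p) →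
                       Unique (map exponents (addMonomial m p))
  addMonomial-unique m []       []          = [] ∷ []
  addMonomial-unique m (m′ ∷ p) (m′∉p ∷ p!)
    with ≡-dec ℕ._≟_ (exponents m) (exponents m′)
  ... | yes _    = m′∉p ∷ p!
  ... | no  m≢m′ =
    -- The head `m′` stays in place; its exponents differ from those of `m` and from those in `p`,
    -- hence from all those in `addMonomial m p`.
    All.map⁺ (addMonomial-All {P = exponents m′ ≢_} (m≢m′ ∘ ≡.sym) (All.map⁻ m′∉p))
      ∷ addMonomial-unique m p p!

  merge-unique : ∀ (p : Polynomial S n) → Unique (map exponents (merge p))
  merge-unique []      = []
  merge-unique (m ∷ p) = addMonomial-unique m (merge p) (merge-unique p)

  -- Padding with powers of `e`.

  pad : ℕ → Monomial S n → Monomial S (2 ℕ.+ n)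
  pad d m = coefficient m ·q^ (0 ∷ (d ∸ degree m) ∷ exponents m)

  -- The leading 0 vanishes by computation, leaving `(d ∸ degree m) + degree m`; the bound prevents
  -- truncation.
  degree-pad : ∀ {d} {m : Monomial S n} → degree m ≤ d → degree (pad d m) ≡ d
  degree-pad = ℕ.m∸n+n≡m

  -- The added exponent falls on `e`, so it contributes a power of 1, whatever `d` is.
  pad-subst : ∀ d (m : Monomial S n) s → s (suc zero) ≈ 1# →
              substMonomial (pad d m) s ≈ substMonomial m (λ i → s (suc (suc i)))
  pad-subst d m s s₁≈1 = *-congˡ (begin
    -- The leading `1#` is the power of `s zero` with exponent 0.
    1# * (s (suc zero) ^ e * sᵏ)  ≈⟨ *-identityˡ _ ⟩
    s (suc zero) ^ e * sᵏ         ≈⟨ *-congʳ (trans (^-congˡ e s₁≈1) (1#^n≈1# e)) ⟩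
    1# * sᵏ                       ≈⟨ *-identityˡ _ ⟩
    sᵏ                            ∎)
    where
    e  = d ∸ degree m
    sᵏ = (λ i → s (suc (suc i))) ^ᵛ exponents m

  pad-⟨⟩ : ∀ d (p : Polynomial S n) s → s (suc zero) ≈ 1# →
           map (pad d) p ⟨ s ⟩ ≈ p ⟨ (λ i → s (suc (suc i))) ⟩
  pad-⟨⟩ d p s s₁≈1 = trans
    (map-⟨⟩ (pad d) 1# s _
      (λ m → trans (pad-subst d m s s₁≈1) (sym (*-identityˡ _))) p)
    (*-identityˡ _)

-- Construction of the equalized automaton.

module Equalization {c ℓ a : Level} (S : CommutativeSemiring c ℓ) (A : Alphabet a)
                    (𝒜 : WAFA S A) where

  open CommutativeSemiring S hiding (zero)
  open PolynomialArithmetic S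
  open SetoidReasoning setoid
  open WAFA 𝒜

  -- State 0 is q₁, state 1 is e, and state 2 + q is the state q of 𝒜; the
  -- indeterminates are still those of 𝒜, since padding introduces e.
  δ° : Fin (2 ℕ.+ ∣Q∣) → Letter A → Polynomial S ∣Q∣
  δ° zero          x = P₀ ⟪ (λ q → δ q x) ⟫
  δ° (suc zero)    x = constant 1#
  δ° (suc (suc q)) x = δ q x

  -- States and letters are both enumerated, so the maximum of the degrees is computable.
  degrees : List ℕ
  degrees = concat (cartesianProductWith (λ q x → map degree (δ° q x))
    (allFin _) (map (Inverse.from (enumeration A)) (allFin _)))

  -- The successor keeps the degree positive even when all listed degrees are 0, which gives
  -- properness.
  commonDegree : ℕ
  commonDegree = suc (max 0 degrees)

  letter∈ : ∀ x → x ∈ map (Inverse.from (enumeration A)) (allFin _)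
  letter∈ x = subst (_∈ _) (Inverse.strictlyInverseʳ (enumeration A) x)
    (∈-map⁺ (Inverse.from (enumeration A)) (∈-allFin _))

  degree≤commonDegree : ∀ q x {m} → m ∈ δ° q x → degree m ≤ commonDegree
  degree≤commonDegree q x m∈ = ℕ.m≤n⇒m≤1+n (All.lookup (xs≤max 0 degrees)
    (∈-concat⁺′ (∈-map⁺ degree m∈)
      (∈-cartesianProductWith⁺ (λ q x → map degree (δ° q x)) (∈-allFin q) (letter∈ x))))

  equalized : WAFA S A
  equalized = record
    { ∣Q∣ = 2 ℕ.+ ∣Q∣
    ; δ   = λ q x → merge (map (pad commonDegree) (δ° q x))
    ; P₀  = indeterminate zero
    -- Each final weight is the intended value at the empty word; `P₀ ⟨ τ ⟩` is the behavior of `𝒜`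
    -- there.
    ; τ   = λ { zero → P₀ ⟨ τ ⟩ ; (suc zero) → 1# ; (suc (suc q)) → τ q }
    }

  -- Padding reaches `commonDegree` exactly, and merging preserves it since the degree depends on
  -- the exponents alone. Both equalization and properness of the transitions follow.
  degree≡commonDegree : ∀ q x {m} → m ∈ WAFA.δ equalized q x →
                        degree m ≡ commonDegree
  degree≡commonDegree q x = All.lookup (merge-All {P = λ k → sum k ≡ commonDegree}
    (All.map⁺ (All.tabulate λ {m} m∈ →
      degree-pad {m = m} (degree≤commonDegree q x m∈))))

  -- Intended values of the states, and their proof by induction on the word.

  value : List (Letter A) → Fin (2 ℕ.+ ∣Q∣) → Carrier
  value w zero          = behavior 𝒜 w
  value w (suc zero)    = 1#
  value w (suc (suc q)) = stateBehavior 𝒜 w q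

  -- For `q₁`, composition turns evaluation at `v` into `P₀` evaluated at the state behaviors of
  -- `x ∷ v`.
  δ°-⟨⟩ : ∀ q x v → δ° q x ⟨ stateBehavior 𝒜 v ⟩ ≈ value (x ∷ v) q
  δ°-⟨⟩ zero          x v = ⟪⟫-⟨⟩ P₀ (λ q → δ q x) _
  δ°-⟨⟩ (suc zero)    x v = constant-⟨⟩ 1# (stateBehavior 𝒜 v)
  δ°-⟨⟩ (suc (suc q)) x v = refl

  stateBehavior≈value : ∀ w q → stateBehavior equalized w q ≈ value w q
  stateBehavior≈value []      zero          = refl
  stateBehavior≈value []      (suc zero)    = refl
  stateBehavior≈value []      (suc (suc q)) = refl
  stateBehavior≈value (x ∷ v) q             = begin
    merge (map (pad commonDegree) (δ° q x)) ⟨ s ⟩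
      ≈⟨ merge-⟨⟩ (map (pad commonDegree) (δ° q x)) s ⟩
    map (pad commonDegree) (δ° q x) ⟨ s ⟩
      -- The induction hypothesis for `e` removes the padding; the one for the states of `𝒜` is
      -- applied next.
      ≈⟨ pad-⟨⟩ commonDegree (δ° q x) s (stateBehavior≈value v (suc zero)) ⟩
    δ° q x ⟨ (λ i → s (suc (suc i))) ⟩
      ≈⟨ ⟨⟩-cong (δ° q x) (λ i → stateBehavior≈value v (suc (suc i))) ⟩
    δ° q x ⟨ stateBehavior 𝒜 v ⟩                   ≈⟨ δ°-⟨⟩ q x v ⟩
    value (x ∷ v) q                                ∎
    where
    s = stateBehavior equalized v

  -- Equivalence, equalization and niceness.

  equivalent : Equivalent 𝒜 equalized
  equivalent w = sym (trans (indeterminate-zero-⟨⟩ (stateBehavior equalized w))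
                            (stateBehavior≈value w zero))

  isEqualized : Equalized equalized
  isEqualized q x q′ x′ m∈ m′∈ =
    ≡.trans (degree≡commonDegree q x m∈) (≡.sym (degree≡commonDegree q′ x′ m′∈))

  isNice : Nice equalized
  isNice = record
    { distinct-monomials = λ q x → merge-unique (map (pad commonDegree) (δ° q x))
    ; δ-proper           = λ q x m∈ d≡0 →
        ℕ.1+n≢0 (≡.trans (≡.sym (degree≡commonDegree q x m∈)) d≡0)
    -- The degree of `indeterminate zero` computes to a successor, so it cannot equal 0.
    ; P₀-proper          = λ { (here ≡.refl) () }
    ; P₀-is-q₁           = zero , ≡.refl , λ _ → refl
    }

lemma3p2 : {c ℓ a : Level} (S : CommutativeSemiring c ℓ) (A : Alphabet a)
    (𝒜 : WAFA S A) →
    ∃[ 𝒜′ ] (Equivalent 𝒜 𝒜′ × Equalized 𝒜′ × Nice 𝒜′)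
lemma3p2 S A 𝒜 = equalized , equivalent , isEqualized , isNice
  where open Equalization S A 𝒜
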